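{- Let $n,m$ be positive integers such that $n,m\geq 3$ and $n\neq m$. Then the complete bipartite graph $K_{n,m}$ is a weak ordered super TAT graph; that is, $K_{n,m}$ admits a total labeling that is simultaneously super, totally antimagic total, and weak ordered.
   Context: All graphs are finite, undirected and simple. $K_{n,m}$ is the complete bipartite graph with partite sets of sizes $n$ and $m$. Let $G$ be a graph with $p=|V(G)|$ vertices and $q=|E(G)|$ edges. A total labeling of $G$ is a bijection $f:V(G)\cup E(G)\to\{1,2,\dots,p+q\}$. It is super if $f(V(G))=\{1,2,\dots,p\}$. The edge-weight of $uv\in E(G)$ is $wt_f(uv)=f(u)+f(uv)+f(v)$, and the vertex-weight of $v\in V(G)$ is $wt_f(v)=f(v)+\sum_{u\in N(v)}f(uv)$, where $N(v)$ is the set of neighbors of $v$. The labeling $f$ is edge-antimagic total (EAT) if all edge-weights are pairwise distinct, and vertex-antimagic total (VAT) if all vertex-weights are pairwise distinct. It is totally antimagic total (TAT) if it is both EAT and VAT. A labeling $f$ is ordered on a set $S$ of vertices if $wt_f(u)\le wt_f(v)$ for every pair $u,v\in S$ with $f(u)<f(v)$. A labeling $f$ of $G$ is weak ordered if, for some positive integer $k$, the vertex set $V(G)$ can be partitioned into $k$ sets on each of which $f$ is ordered. A graph is a weak ordered super TAT graph if it admits a total labeling that is weak ordered, super and TAT. -}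

module Defs where

open import Algebra.Properties.CommutativeMonoid.Sum using (sum)
open import Data.Fin using (Fin; toℕ)
open import Data.Fin.Properties using (any?; +↔⊎; *↔×)
import Data.Fin.Properties as Fin
open import Data.Nat using (ℕ; suc; _+_; _*_; _≤_; _<_)
open import Data.Nat.Properties using (+-0-commutativeMonoid)
open import Data.Product using (Σ; ∃; _×_; _,_; proj₁; proj₂)
open import Data.Product.Properties using (≡-dec)
open import Data.Sum using (_⊎_; inj₁; inj₂)
open import Function using (_∘_; _↔_; _⤖_; _⇔_; Inverse; Bijection; Injective; Surjective)
open import Function.Properties.Inverse using (↔-sym; Inverse⇒Injection)
open import Level using (0ℓ)
open import Relation.Binary.Definitions using (DecidableEquality)
open import Relation.Binary.PropositionalEquality using (_≡_; refl; sym; subst)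
open import Relation.Nullary using (¬_; Dec; yes; no)
open import Relation.Nullary.Decidable using (map′; via-injection; _⊎-dec_)
open import Relation.Unary using (Pred; _∈_)

-- `ends` lists the two endpoints of an edge in an arbitrary order; `Joins`
-- forgets that order, so an edge is determined by an unordered pair.
record Graph : Set₁ where
  field
    V E  : Set
    p q  : ℕ
    V↔   : V ↔ Fin p
    E↔   : E ↔ Fin q
    ends : E → V × V

  Joins : E → V → V → Set
  Joins e u v = (ends e ≡ (u , v)) ⊎ (ends e ≡ (v , u))

  field
    loopless : ∀ e v → ¬ Joins e v v
    simple   : ∀ {e e′ u v} → Joins e u v → Joins e′ u v → e ≡ e′

  Adjacent : V → V → Set
  Adjacent u v = ∃ λ e → Joins e u v

  _≟V_ : DecidableEquality V
  _≟V_ = via-injection (Inverse⇒Injection V↔) Fin._≟_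

  joins? : ∀ e u v → Dec (Joins e u v)
  joins? e u v = ≡-dec _≟V_ _≟V_ (ends e) (u , v) ⊎-dec ≡-dec _≟V_ _≟V_ (ends e) (v , u)

  adjacent? : ∀ u v → Dec (Adjacent u v)
  adjacent? u v = map′
    (λ (i , j) → Inverse.from E↔ i , j)
    (λ (e , j) → Inverse.to E↔ e ,
                 subst (λ e′ → Joins e′ u v) (sym (Inverse.strictlyInverseʳ E↔ e)) j)
    (any? λ i → joins? (Inverse.from E↔ i) u v)

  sumV : (V → ℕ) → ℕ
  sumV g = sum +-0-commutativeMonoid (g ∘ Inverse.from V↔)

module _ (G : Graph) where
  open Graph G

  -- The element i of Fin (p + q) stands for the label i + 1.
  TotalLabeling : Set
  TotalLabeling = (V ⊎ E) ⤖ Fin (p + q)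

module Labeling (G : Graph) (f : TotalLabeling G) where
  open Graph G

  label : V ⊎ E → ℕ
  label x = suc (toℕ (Bijection.to f x))

  labelV : V → ℕ
  labelV v = label (inj₁ v)

  labelE : E → ℕ
  labelE e = label (inj₂ e)

  wtE : E → ℕ
  wtE e = labelV (proj₁ (ends e)) + labelE e + labelV (proj₂ (ends e))

  -- Label of the edge uv if u and v are adjacent; 0 otherwise, so that summing
  -- over all u amounts to summing over u ∈ N(v).
  edgeTerm : V → V → ℕ
  edgeTerm u v with adjacent? u v
  ... | yes (e , _) = labelE e
  ... | no _        = 0

  wtV : V → ℕ
  wtV v = labelV v + sumV (λ u → edgeTerm u v)

  Super : Set
  Super = ∀ k → (∃ λ v → labelV v ≡ k) ⇔ (1 ≤ k × k ≤ p)

  EAT : Set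
  EAT = Injective _≡_ _≡_ wtE

  VAT : Set
  VAT = Injective _≡_ _≡_ wtV

  TAT : Set
  TAT = EAT × VAT

  OrderedOn : Pred V 0ℓ → Set
  OrderedOn S = ∀ {u v} → u ∈ S → v ∈ S → labelV u < labelV v → wtV u ≤ wtV v

  -- A partition into k sets is given by the map sending a vertex to the index
  -- of its block; surjectivity says that the blocks are nonempty.
  WeakOrdered : Set
  WeakOrdered = Σ ℕ λ k → 1 ≤ k × Σ (V → Fin k) λ block →
    Surjective _≡_ _≡_ block × (∀ i → OrderedOn (λ v → block v ≡ i))

WeakOrderedSuperTATGraph : Graph → Set
WeakOrderedSuperTATGraph G = Σ (TotalLabeling G) λ f →
  let open Labeling G f in WeakOrdered × Super × TAT

K : ℕ → ℕ → Graph
K n m = record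
  { V        = Fin n ⊎ Fin m
  ; E        = Fin n × Fin m
  ; p        = n + m
  ; q        = n * m
  ; V↔       = ↔-sym +↔⊎
  ; E↔       = ↔-sym *↔×
  ; ends     = λ (i , j) → inj₁ i , inj₂ j
  ; loopless = λ { e v (inj₁ ()) ; e v (inj₂ ()) }
  ; simple   = λ { (inj₁ refl) (inj₁ refl) → refl
                 ; (inj₁ refl) (inj₂ ())
                 ; (inj₂ refl) (inj₁ ())
                 ; (inj₂ refl) (inj₂ refl) → refl }
  }

{-# OPTIONS --safe #-}
module Submission where

-- Label the edges row by row: e(i,j) = m i + j, up to a constant. The edge weights are then
-- distinct for suitable vertex labels: if m is even, the columns get an interval of m consecutive
-- labels and the rows the remaining ones; if n and m are odd, the rows get an interval placed so
-- that half of the column labels (rounded) lie on either side of it. In both cases the weights of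
-- the rows increase, as do those of the columns, so only a row and a column can have the same
-- weight. Moving the interval shifts row weights against column weights by single units, while
-- the differences of row weights and of column weights are close to multiples of m² + 1 and
-- n + 1; hence not all of two (or three) positions of the interval can produce a coincidence.
-- The remaining parities follow by transposition.

open import Defs
open import Algebra.Properties.CommutativeMonoid.Sum using ()
open import Data.Empty using (⊥)
open import Data.Fin using (Fin; zero; suc; toℕ; fromℕ<; _↑ˡ_; _↑ʳ_; splitAt; punchOut; combine)
open import Data.Fin.Properties
  using ( any?; +↔⊎; toℕ<n; toℕ-injective; toℕ-fromℕ<; toℕ-↑ˡ; toℕ-↑ʳ; toℕ-combine
        ; punchOut-injective; injective⇒≤)
import Data.Fin.Properties as Fin
open import Data.Nat
open import Data.Nat.Properties
open import Data.Nat.Tactic.RingSolver using (solve-∀)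
open import Data.Product using (∃; _×_; _,_; proj₁; proj₂; uncurry; swap)
open import Data.Product.Properties using (×-≡,≡→≡)
open import Data.Sum using (_⊎_; inj₁; inj₂; [_,_]′)
open import Data.Sum.Function.Propositional using (_⊎-↔_)
open import Function using (_∘_; _↔_; Inverse; Injection; Injective; StrictlySurjective; mk⤖; mk⇔)
open import Function.Consequences.Propositional using (strictlySurjective⇒surjective)
open import Function.Construct.Composition using (_↔-∘_)
open import Function.Properties.Inverse using (↔-sym; ↔⇒↣)
open import Relation.Binary.Definitions using (tri<; tri≈; tri>)
open import Relation.Binary.PropositionalEquality
  using (_≡_; _≢_; refl; sym; trans; cong; cong₂; subst; module ≡-Reasoning)
open import Relation.Nullary using (¬_; Dec; yes; no; contradiction)

open Algebra.Properties.CommutativeMonoid.Sum +-0-commutativeMonoid using (sum; sum-cong-≗)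

-- Super labelings from separate numberings of vertices and edges

-- Pigeonhole: a missed value `y` could be punched out of the codomain, leaving an injection of
-- `Fin (suc k)` into `Fin k`.
injective⇒strictlySurjective : ∀ {A : Set} {k} → A ↔ Fin k → {f : A → Fin k} →
  Injective _≡_ _≡_ f → StrictlySurjective _≡_ f
injective⇒strictlySurjective {k = suc k} A↔ {f} f-inj y with any? (λ i → f (Inverse.from A↔ i) Fin.≟ y)
... | yes (i , eq) = Inverse.from A↔ i , eq
... | no ∄i        = contradiction (injective⇒≤ out-inj) 1+n≰n
  where
  miss : ∀ i → y ≢ f (Inverse.from A↔ i)
  miss i eq = ∄i (i , sym eq)
  out-inj : Injective _≡_ _≡_ (λ i → punchOut (miss i))
  out-inj {i} {j} eq = Injection.injective (↔⇒↣ (↔-sym A↔))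
    (f-inj (punchOut-injective (miss i) (miss j) eq))
injective⇒strictlySurjective {k = zero} A↔ f-inj ()

module SuperLabeling (G : Graph)
  (ν : Graph.V G → ℕ) (ν< : ∀ v → ν v < Graph.p G) (ν-inj : Injective _≡_ _≡_ ν)
  (ε : Graph.E G → ℕ) (ε< : ∀ e → ε e < Graph.q G) (ε-inj : Injective _≡_ _≡_ ε)
  where

  open Graph G

  index : V ⊎ E → Fin (p + q)
  index (inj₁ v) = fromℕ< (ν< v) ↑ˡ q
  index (inj₂ e) = p ↑ʳ fromℕ< (ε< e)

  toℕ-index-V : ∀ v → toℕ (index (inj₁ v)) ≡ ν v
  toℕ-index-V v = trans (toℕ-↑ˡ _ q) (toℕ-fromℕ< (ν< v))

  toℕ-index-E : ∀ e → toℕ (index (inj₂ e)) ≡ p + ε e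
  toℕ-index-E e = trans (toℕ-↑ʳ p _) (cong (p +_) (toℕ-fromℕ< (ε< e)))

  ν≢p+ε : ∀ v e → ν v ≢ p + ε e
  ν≢p+ε v e eq = <⇒≢ (<-≤-trans (ν< v) (m≤m+n p (ε e))) eq

  index-inj : Injective _≡_ _≡_ index
  index-inj {inj₁ u} {inj₁ v} eq = cong inj₁ (ν-inj
    (trans (sym (toℕ-index-V u)) (trans (cong toℕ eq) (toℕ-index-V v))))
  index-inj {inj₁ u} {inj₂ e} eq = contradiction
    (trans (sym (toℕ-index-V u)) (trans (cong toℕ eq) (toℕ-index-E e))) (ν≢p+ε u e)
  index-inj {inj₂ e} {inj₁ u} eq = contradiction
    (trans (sym (toℕ-index-V u)) (trans (cong toℕ (sym eq)) (toℕ-index-E e))) (ν≢p+ε u e)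
  index-inj {inj₂ d} {inj₂ e} eq = cong inj₂ (ε-inj (+-cancelˡ-≡ p _ _
    (trans (sym (toℕ-index-E d)) (trans (cong toℕ eq) (toℕ-index-E e)))))

  index-surj : StrictlySurjective _≡_ index
  index-surj = injective⇒strictlySurjective (↔-sym +↔⊎ ↔-∘ (V↔ ⊎-↔ E↔)) index-inj

  labeling : TotalLabeling G
  labeling = mk⤖ (index-inj , strictlySurjective⇒surjective index-surj)

  open Labeling G labeling public

  labelV≡ : ∀ v → labelV v ≡ suc (ν v)
  labelV≡ v = cong suc (toℕ-index-V v)

  labelE≡ : ∀ e → labelE e ≡ suc p + ε e
  labelE≡ e = cong suc (toℕ-index-E e)

  super : Super
  super k = mk⇔ to from
    where
    to : (∃ λ v → labelV v ≡ k) → 1 ≤ k × k ≤ p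
    to (v , refl) = s≤s z≤n , subst (_≤ p) (sym (labelV≡ v)) (ν< v)
    from : 1 ≤ k × k ≤ p → ∃ λ v → labelV v ≡ k
    from (s≤s {n = k′} z≤n , k<p)
      with index-surj (fromℕ< k<p ↑ˡ q)
    ... | inj₁ v , eq = v , cong suc (trans (cong toℕ eq) (trans (toℕ-↑ˡ _ q) (toℕ-fromℕ< k<p)))
    -- An edge has index at least `p`, so every smaller index is hit by a vertex.
    ... | inj₂ e , eq = contradiction
            (trans (sym (toℕ-index-E e))
              (trans (cong toℕ eq) (trans (toℕ-↑ˡ _ q) (toℕ-fromℕ< k<p))))
            (λ eq′ → <⇒≱ k<p (subst (p ≤_) eq′ (m≤m+n p (ε e))))

-- Singleton blocks are vacuously ordered.
weakOrdered : ∀ G f → 1 ≤ Graph.p G → Labeling.WeakOrdered G f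
weakOrdered G f 1≤p = p , 1≤p , Inverse.to V↔ ,
  strictlySurjective⇒surjective (λ i → Inverse.from V↔ i , Inverse.strictlyInverseˡ V↔ i) ,
  λ { i {u} {v} refl eq u<v → contradiction
        (cong labelV (sym (Injection.injective (↔⇒↣ V↔) eq))) (<⇒≢ u<v) }
  where
  open Graph G
  open Labeling G f

-- Weights in the complete bipartite graph

-- `K n m` enumerates its vertices through `splitAt n`; this breaks `sumV` into the contributions of
-- the two sides.
sum-splitAt : ∀ n {m} (g : Fin n ⊎ Fin m → ℕ) →
  sum (g ∘ splitAt n) ≡ sum (g ∘ inj₁) + sum (g ∘ inj₂)
sum-splitAt zero    g = refl
sum-splitAt (suc n) {m} g = begin
  g (inj₁ zero) + sum (λ i → g (splitAt (suc n) (suc i)))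
    ≡⟨ cong (g (inj₁ zero) +_) (trans (sum-cong-≗ step) (sum-splitAt n g′)) ⟩
  g (inj₁ zero) + (sum (g ∘ inj₁ ∘ suc) + sum (g ∘ inj₂))
    ≡⟨ +-assoc (g (inj₁ zero)) _ _ ⟨
  sum (g ∘ inj₁) + sum (g ∘ inj₂) ∎
  where
  open ≡-Reasoning
  g′ : Fin n ⊎ Fin m → ℕ
  g′ = [ g ∘ inj₁ ∘ suc , g ∘ inj₂ ]′
  step : ∀ i → g (splitAt (suc n) (suc i)) ≡ g′ (splitAt n i)
  step i with splitAt n i
  ... | inj₁ _ = refl
  ... | inj₂ _ = refl

sum-zero : ∀ n → sum {n} (λ _ → 0) ≡ 0
sum-zero zero    = refl
sum-zero (suc n) = sum-zero n

-- Zero-based labels: the vertices get the labels a i + 1 and b j + 1, the edges n + m + e i j + 1.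
record Scheme (n m : ℕ) : Set where
  field
    a : Fin n → ℕ
    b : Fin m → ℕ
    e : Fin n → Fin m → ℕ

  row : Fin n → ℕ
  row i = a i + sum (λ j → suc (n + m) + e i j)

  col : Fin m → ℕ
  col j = b j + sum (λ i → suc (n + m) + e i j)

  field
    a<    : ∀ i → a i < n + m
    b<    : ∀ j → b j < n + m
    e<    : ∀ i j → e i j < n * m
    a-inj : Injective _≡_ _≡_ a
    b-inj : Injective _≡_ _≡_ b
    a≢b   : ∀ i j → a i ≢ b j
    e-inj : ∀ {i i′ j j′} → e i j ≡ e i′ j′ → i ≡ i′ × j ≡ j′
    w-inj : ∀ {i i′ j j′} → a i + e i j + b j ≡ a i′ + e i′ j′ + b j′ → i ≡ i′ × j ≡ j′
    row-inj : Injective _≡_ _≡_ row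
    col-inj : Injective _≡_ _≡_ col
    row≢col : ∀ i j → row i ≢ col j

[,]-injective : ∀ {A B C : Set} {f : A → C} {g : B → C} → Injective _≡_ _≡_ f → Injective _≡_ _≡_ g →
  (∀ x y → f x ≢ g y) → Injective _≡_ _≡_ [ f , g ]′
[,]-injective f-inj g-inj f≢g {inj₁ x} {inj₁ y} eq = cong inj₁ (f-inj eq)
[,]-injective f-inj g-inj f≢g {inj₁ x} {inj₂ y} eq = contradiction eq (f≢g x y)
[,]-injective f-inj g-inj f≢g {inj₂ x} {inj₁ y} eq = contradiction (sym eq) (f≢g y x)
[,]-injective f-inj g-inj f≢g {inj₂ x} {inj₂ y} eq = cong inj₂ (g-inj eq)

-- All weights survive the exchange of the sides up to commutativity, so a construction may assume
-- which side is even, or which is smaller.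
transpose : ∀ {n m} → Scheme n m → Scheme m n
transpose {n} {m} S = record
  { a = b ; b = a ; e = λ j i → e i j
  ; a< = λ j → subst (b j <_) (+-comm n m) (b< j)
  ; b< = λ i → subst (a i <_) (+-comm n m) (a< i)
  ; e< = λ j i → subst (e i j <_) (*-comm n m) (e< i j)
  ; a-inj = b-inj ; b-inj = a-inj
  ; a≢b = λ j i eq → a≢b i j (sym eq)
  ; e-inj = swap ∘ e-inj
  ; w-inj = λ {j} {j′} {i} {i′} eq →
      swap (w-inj (trans (reverse (a i) _ _) (trans eq (sym (reverse (a i′) _ _)))))
  ; row-inj = λ {j} {j′} eq → col-inj (trans (col≡ j) (trans eq (sym (col≡ j′))))
  ; col-inj = λ {i} {i′} eq → row-inj (trans (row≡ i) (trans eq (sym (row≡ i′))))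
  ; row≢col = λ j i eq → row≢col i j (trans (row≡ i) (trans (sym eq) (sym (col≡ j))))
  }
  where
  open Scheme S
  reverse : ∀ x y z → x + y + z ≡ z + y + x
  reverse x y z = trans (+-comm (x + y) z) (trans (cong (z +_) (+-comm x y)) (sym (+-assoc z y x)))
  col≡ : ∀ j → col j ≡ b j + sum (λ i → suc (m + n) + e i j)
  col≡ j = cong (λ k → b j + sum (λ i → suc k + e i j)) (+-comm n m)
  row≡ : ∀ i → row i ≡ a i + sum (λ j → suc (m + n) + e i j)
  row≡ i = cong (λ k → a i + sum (λ j → suc k + e i j)) (+-comm n m)

module _ {n m : ℕ} (S : Scheme n m) where
  open Scheme S

  [a,b]< : ∀ v → [ a , b ]′ v < n + m
  [a,b]< (inj₁ i) = a< i
  [a,b]< (inj₂ j) = b< j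

  private
    module L = SuperLabeling (K n m)
      [ a , b ]′ [a,b]< ([,]-injective a-inj b-inj a≢b) (uncurry e) (uncurry e<) (×-≡,≡→≡ ∘ e-inj)

  wtV-row : ∀ i → L.wtV (inj₁ i) ≡ suc (row i)
  wtV-row i = cong₂ _+_ (L.labelV≡ (inj₁ i)) (begin
    sum (g ∘ splitAt n)              ≡⟨ sum-splitAt n g ⟩
    sum (g ∘ inj₁) + sum (g ∘ inj₂)  ≡⟨ cong₂ _+_ (trans (sum-cong-≗ same) (sum-zero n)) (sum-cong-≗ cross) ⟩
    sum (λ j → suc (n + m) + e i j)  ∎)
    where
    open ≡-Reasoning
    g : Fin n ⊎ Fin m → ℕ
    g u = L.edgeTerm u (inj₁ i)
    same : ∀ i′ → g (inj₁ i′) ≡ 0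
    same i′ with Graph.adjacent? (K n m) (inj₁ i′) (inj₁ i)
    ... | yes (_ , inj₁ ())
    ... | yes (_ , inj₂ ())
    ... | no _ = refl
    cross : ∀ j → g (inj₂ j) ≡ suc (n + m) + e i j
    cross j with Graph.adjacent? (K n m) (inj₂ j) (inj₁ i)
    ... | yes (_ , inj₂ refl) = L.labelE≡ (i , j)
    ... | no ¬adj = contradiction ((i , j) , inj₂ refl) ¬adj

  wtV-col : ∀ j → L.wtV (inj₂ j) ≡ suc (col j)
  wtV-col j = cong₂ _+_ (L.labelV≡ (inj₂ j)) (begin
    sum (g ∘ splitAt n)              ≡⟨ sum-splitAt n g ⟩
    sum (g ∘ inj₁) + sum (g ∘ inj₂)  ≡⟨ cong₂ _+_ (sum-cong-≗ cross) (trans (sum-cong-≗ same) (sum-zero m)) ⟩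
    sum (λ i → suc (n + m) + e i j) + 0  ≡⟨ +-identityʳ _ ⟩
    sum (λ i → suc (n + m) + e i j)  ∎)
    where
    open ≡-Reasoning
    g : Fin n ⊎ Fin m → ℕ
    g u = L.edgeTerm u (inj₂ j)
    same : ∀ j′ → g (inj₂ j′) ≡ 0
    same j′ with Graph.adjacent? (K n m) (inj₂ j′) (inj₂ j)
    ... | yes (_ , inj₁ ())
    ... | yes (_ , inj₂ ())
    ... | no _ = refl
    cross : ∀ i → g (inj₁ i) ≡ suc (n + m) + e i j
    cross i with Graph.adjacent? (K n m) (inj₁ i) (inj₂ j)
    ... | yes (_ , inj₁ refl) = L.labelE≡ (i , j)
    ... | no ¬adj = contradiction ((i , j) , inj₁ refl) ¬adj

  scheme⇒graph : 1 ≤ n + m → WeakOrderedSuperTATGraph (K n m)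
  scheme⇒graph 1≤n+m = L.labeling , weakOrdered (K n m) L.labeling 1≤n+m , L.super , eat , vat
    where
    c : ℕ
    -- One unit for each of the two vertex labels and `suc (n + m)` for the edge label.
    c = suc (suc (suc (n + m)))
    wt≡ : ∀ i j → L.wtE (i , j) ≡ c + (a i + e i j + b j)
    wt≡ i j = trans
      (cong₂ _+_ (cong₂ _+_ (L.labelV≡ (inj₁ i)) (L.labelE≡ (i , j))) (L.labelV≡ (inj₂ j)))
      (shift (a i) (e i j) (b j) (n + m))
      where
      shift : ∀ x y z k → suc x + (suc k + y) + suc z ≡ suc (suc (suc k)) + (x + y + z)
      shift = solve-∀
    eat : L.EAT
    eat {i , j} {i′ , j′} eq = ×-≡,≡→≡ (w-inj (+-cancelˡ-≡ c _ _
      (trans (sym (wt≡ i j)) (trans eq (wt≡ i′ j′)))))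
    vat : L.VAT
    vat {u} {v} eq = [,]-injective row-inj col-inj row≢col
      (suc-injective (trans (sym (wt≡′ u)) (trans eq (wt≡′ v))))
      where
      wt≡′ : ∀ v → L.wtV v ≡ suc ([ row , col ]′ v)
      wt≡′ (inj₁ i) = wtV-row i
      wt≡′ (inj₂ j) = wtV-col j

-- Arithmetic progressions and division with remainder

-- The sum 0 + 1 + ... + (n - 1), that is, the sum of `toℕ` over `Fin n`.
triangle : ℕ → ℕ
triangle zero    = 0
triangle (suc n) = n + triangle n

2*triangle : ∀ n → 2 * triangle (suc n) ≡ suc n * n
2*triangle zero    = refl
2*triangle (suc n) = begin
  2 * (suc n + triangle (suc n))    ≡⟨ *-distribˡ-+ 2 (suc n) (triangle (suc n)) ⟩
  2 * suc n + 2 * triangle (suc n)  ≡⟨ cong (2 * suc n +_) (2*triangle n) ⟩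
  2 * suc n + suc n * n             ≡⟨ ring n ⟩
  suc (suc n) * suc n               ∎
  where
  open ≡-Reasoning
  ring : ∀ n → 2 * suc n + suc n * n ≡ suc (suc n) * suc n
  ring = solve-∀

triangle-mono-≤ : ∀ {m n} → m ≤ n → triangle m ≤ triangle n
triangle-mono-≤ z≤n       = z≤n
triangle-mono-≤ (s≤s m≤n) = +-mono-≤ m≤n (triangle-mono-≤ m≤n)

sum-affine : ∀ n c d → sum {n} (λ i → c + d * toℕ i) ≡ n * c + d * triangle n
sum-affine zero    c d = sym (*-zeroʳ d)
sum-affine (suc n) c d = begin
  c + d * 0 + sum {n} (λ i → c + d * suc (toℕ i))
    ≡⟨ cong (c + d * 0 +_) (sum-cong-≗ {n} λ i → shift c d (toℕ i)) ⟩
  c + d * 0 + sum {n} (λ i → c + d + d * toℕ i)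
    ≡⟨ cong (c + d * 0 +_) (sum-affine n (c + d) d) ⟩
  c + d * 0 + (n * (c + d) + d * triangle n)
    ≡⟨ ring n c d (triangle n) ⟩
  suc n * c + d * triangle (suc n) ∎
  where
  open ≡-Reasoning
  shift : ∀ c d x → c + d * suc x ≡ c + d + d * x
  shift = solve-∀
  ring : ∀ n c d t → c + d * 0 + (n * (c + d) + d * t) ≡ suc n * c + d * (n + t)
  ring = solve-∀

StrictlyMonotone : (ℕ → ℕ) → Set
StrictlyMonotone f = ∀ {x y} → x < y → f x < f y

strictlyMonotone⇒injective : ∀ {f} → StrictlyMonotone f → ∀ {x y} → f x ≡ f y → x ≡ y
strictlyMonotone⇒injective f-mono {x} {y} eq with <-cmp x y
... | tri< x<y _ _ = contradiction eq (<⇒≢ (f-mono x<y))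
... | tri≈ _ x≡y _ = x≡y
... | tri> _ _ y<x = contradiction (sym eq) (<⇒≢ (f-mono y<x))

-- Since `s` times the difference of the quotients is the difference of the remainders, a bound on
-- the latter bounds the former. The remainders may exceed `s`.
digit-< : ∀ s d {x x′ r r′} → s * x + r ≡ s * x′ + r′ → r′ < s * d + r → x < x′ + d
digit-< s d {x} {x′} {r} {r′} eq r′<sd+r = ≰⇒> λ x′+d≤x → <⇒≢ (begin-strict
  s * x′ + r′           <⟨ +-monoʳ-< (s * x′) r′<sd+r ⟩
  s * x′ + (s * d + r)  ≡⟨ ring s x′ d r ⟩
  s * (x′ + d) + r      ≤⟨ +-monoˡ-≤ r (*-monoʳ-≤ s x′+d≤x) ⟩
  s * x + r             ∎) (sym eq)
  where
  open ≤-Reasoning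
  ring : ∀ s x d r → s * x + (s * d + r) ≡ s * (x + d) + r
  ring = solve-∀

digit-≡ : ∀ s {x x′ r r′} → s * x + r ≡ s * x′ + r′ → r < s + r′ → r′ < s + r → x ≡ x′
digit-≡ s {x} {x′} {r} {r′} eq r<s+r′ r′<s+r = ≤-antisym
  (half eq r′<s+r) (half (sym eq) r<s+r′)
  where
  half : ∀ {x x′ r r′} → s * x + r ≡ s * x′ + r′ → r′ < s + r → x ≤ x′
  half {x} {x′} {r} {r′} eq lt = +-cancelʳ-≤ 1 _ _ (subst (_≤ x′ + 1) (+-comm 1 x)
    (digit-< s 1 eq (subst (λ z → r′ < z + r) (sym (*-identityʳ s)) lt)))

digits-≡ : ∀ s {x x′ r r′} → r < s → r′ < s → s * x + r ≡ s * x′ + r′ → x ≡ x′ × r ≡ r′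
digits-≡ s {x} r<s r′<s eq
  with refl ← digit-≡ s {x} eq (m≤n⇒m≤n+o _ r<s) (m≤n⇒m≤n+o _ r′<s)
  = refl , +-cancelˡ-≡ (s * x) _ _ eq

-- Subtraction-free difference of two equations. Applied to two collisions, it eliminates the
-- constants `rowBase` and `colBase`.
cross : ∀ {u v u′ v′} a b → u + a ≡ v + b → u′ + a ≡ v′ + b → u + v′ ≡ u′ + v
cross {u} {v} {u′} {v′} a b eq eq′ = +-cancelʳ-≡ (a + b) _ _ (begin
  u + v′ + (a + b)    ≡⟨ ring u v′ a b ⟩
  u + a + (v′ + b)    ≡⟨ cong₂ _+_ eq (sym eq′) ⟩
  v + b + (u′ + a)    ≡⟨ ring′ v b u′ a ⟩
  u′ + v + (a + b)    ∎)
  where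
  open ≡-Reasoning
  ring : ∀ u v a b → u + v + (a + b) ≡ u + a + (v + b)
  ring = solve-∀
  ring′ : ∀ v b u a → v + b + (u + a) ≡ u + v + (a + b)
  ring′ = solve-∀

neighbours : ∀ {x y} → x ≢ y → x < y + 2 → y < x + 2 → y ≡ suc x ⊎ x ≡ suc y
neighbours {x} {y} x≢y x<y+2 y<x+2 with <-cmp x y
... | tri< x<y _ _ = inj₁ (≤-antisym (s≤s⁻¹ (subst (y <_) (+-comm x 2) y<x+2)) x<y)
... | tri≈ _ x≡y _ = contradiction x≡y x≢y
... | tri> _ _ y<x = inj₂ (≤-antisym (s≤s⁻¹ (subst (x <_) (+-comm y 2) x<y+2)) y<x)

-- Among three distinct numbers, the largest and the smallest differ by at least 2.
¬-three-close : ∀ {i j k} → i ≢ j → i ≢ k → j ≢ k →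
  i < j + 2 → j < i + 2 → i < k + 2 → k < i + 2 → j < k + 2 → k < j + 2 → ⊥
¬-three-close {i} {j} {k} i≢j i≢k j≢k i<j+2 j<i+2 i<k+2 k<i+2 j<k+2 k<j+2
  with neighbours i≢j i<j+2 j<i+2
... | inj₁ refl with neighbours i≢k i<k+2 k<i+2
...   | inj₁ refl = j≢k refl
...   | inj₂ refl = <-irrefl (+-comm 2 k) j<k+2
¬-three-close {i} {j} {k} i≢j i≢k j≢k i<j+2 j<i+2 i<k+2 k<i+2 j<k+2 k<j+2
    | inj₂ refl with neighbours j≢k j<k+2 k<j+2
...   | inj₁ refl = i≢k refl
...   | inj₂ refl = <-irrefl (+-comm 2 k) i<k+2

-- Labels outside an interval

-- Enumerates the complement of the interval [t , t + k).
gap : ℕ → ℕ → ℕ → ℕ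
gap zero    k x       = x + k
gap (suc t) k zero    = 0
gap (suc t) k (suc x) = suc (gap t k x)

gap-cases : ∀ t k x → (x < t × gap t k x ≡ x) ⊎ (t ≤ x × gap t k x ≡ x + k)
gap-cases zero    k x       = inj₂ (z≤n , refl)
gap-cases (suc t) k zero    = inj₁ (z<s , refl)
gap-cases (suc t) k (suc x) with gap-cases t k x
... | inj₁ (x<t , eq) = inj₁ (s<s x<t , cong suc eq)
... | inj₂ (t≤x , eq) = inj₂ (s≤s t≤x , cong suc eq)

gap-≤ : ∀ t k x → gap t k x ≤ x + k
gap-≤ zero    k x       = ≤-refl
gap-≤ (suc t) k zero    = z≤n
gap-≤ (suc t) k (suc x) = s≤s (gap-≤ t k x)

gap-below : ∀ {t k x} → x < t → gap t k x ≡ x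
gap-below {suc t} {k} {zero}  _         = refl
gap-below {suc t} {k} {suc x} (s≤s x<t) = cong suc (gap-below x<t)

gap-above : ∀ {t k x} → t ≤ x → gap t k x ≡ x + k
gap-above z≤n       = refl
gap-above (s≤s t≤x) = cong suc (gap-above t≤x)

gap-mono : ∀ t k → StrictlyMonotone (gap t k)
gap-mono zero    k x<y             = +-monoˡ-< k x<y
gap-mono (suc t) k (z<s)           = z<s
gap-mono (suc t) k (s<s x<y@(s≤s _)) = s<s (gap-mono t k x<y)

gap-avoids : ∀ t k x {y} → y < k → gap t k x ≢ t + y
gap-avoids zero    k x       y<k eq = <⇒≱ y<k (subst (k ≤_) eq (m≤n+m k x))
gap-avoids (suc t) k zero    y<k ()
gap-avoids (suc t) k (suc x) y<k eq = gap-avoids t k x y<k (suc-injective eq)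

-- Row-by-row edge labels with two kinds of vertex labels

module _ (n m : ℕ) where

  -- The parts of the weights common to all rows and to all columns: the offset `suc (n + m)` of
  -- each incident edge, and the sum over the other coordinate of its share in the edge number
  -- `m * x + y`.
  rowBase colBase : ℕ
  rowBase = m * suc (n + m) + triangle m
  colBase = n * suc (n + m) + m * triangle n

  rowWeight colWeight : (ℕ → ℕ) → ℕ → ℕ
  rowWeight α x = α x + m * m * x + rowBase
  colWeight β y = β y + n * y + colBase

  -- Monotone vertex labels make row weights and column weights increase. Along a fixed row the edge
  -- weight increases with `y`, so for edges it is enough that the weight determines the row.
  rowMajor : (α β : ℕ → ℕ) → StrictlyMonotone α → StrictlyMonotone β →
    (∀ {x} → x < n → α x < n + m) → (∀ {y} → y < m → β y < n + m) →
    (∀ {x y} → x < n → y < m → α x ≢ β y) →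
    (∀ {x x′ y y′} → x < n → x′ < n → y < m → y′ < m →
      α x + (m * x + y) + β y ≡ α x′ + (m * x′ + y′) + β y′ → x ≡ x′) →
    (∀ {x y} → x < n → y < m → rowWeight α x ≢ colWeight β y) →
    Scheme n m
  rowMajor α β α-mono β-mono α< β< α≢β w-inj row≢col = record
    { a = α ∘ toℕ
    ; b = β ∘ toℕ
    ; e = λ i j → m * toℕ i + toℕ j
    ; a< = α< ∘ toℕ<n
    ; b< = β< ∘ toℕ<n
    -- `combine i j` has exactly this value, and its type carries the bound.
    ; e< = λ i j → subst (_< n * m) (toℕ-combine i j) (toℕ<n (combine i j))
    ; a-inj = toℕ-injective ∘ strictlyMonotone⇒injective α-mono
    ; b-inj = toℕ-injective ∘ strictlyMonotone⇒injective β-mono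
    ; a≢b = λ i j → α≢β (toℕ<n i) (toℕ<n j)
    ; e-inj = λ {i} {i′} {j} {j′} eq →
        let x≡x′ , y≡y′ = digits-≡ m (toℕ<n j) (toℕ<n j′) eq in
        toℕ-injective x≡x′ , toℕ-injective y≡y′
    ; w-inj = λ {i} {i′} {j} {j′} eq → both i i′ j j′
        (w-inj (toℕ<n i) (toℕ<n i′) (toℕ<n j) (toℕ<n j′) eq) eq
    ; row-inj = λ {i} {i′} eq → toℕ-injective (strictlyMonotone⇒injective rowWeight-mono
        (trans (sym (row≡ i)) (trans eq (row≡ i′))))
    ; col-inj = λ {j} {j′} eq → toℕ-injective (strictlyMonotone⇒injective colWeight-mono
        (trans (sym (col≡ j)) (trans eq (col≡ j′))))
    ; row≢col = λ i j eq → row≢col (toℕ<n i) (toℕ<n j)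
        (trans (sym (row≡ i)) (trans eq (col≡ j)))
    }
    where
    open ≡-Reasoning
    P = suc (n + m)

    row≡ : ∀ i → α (toℕ i) + sum {m} (λ j → P + (m * toℕ i + toℕ j)) ≡ rowWeight α (toℕ i)
    row≡ i = begin
      α x + sum {m} (λ j → P + (m * x + toℕ j))
        ≡⟨ cong (α x +_) (sum-cong-≗ {m} λ j → ring₁ P m x (toℕ j)) ⟩
      α x + sum {m} (λ j → P + m * x + 1 * toℕ j)
        ≡⟨ cong (α x +_) (sum-affine m (P + m * x) 1) ⟩
      α x + (m * (P + m * x) + 1 * triangle m)
        ≡⟨ ring₂ (α x) m P x (triangle m) ⟩
      rowWeight α x ∎
      where
      x = toℕ i
      ring₁ : ∀ p m x y → p + (m * x + y) ≡ p + m * x + 1 * y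
      ring₁ = solve-∀
      ring₂ : ∀ a m p x t → a + (m * (p + m * x) + 1 * t) ≡ a + m * m * x + (m * p + t)
      ring₂ = solve-∀

    col≡ : ∀ j → β (toℕ j) + sum {n} (λ i → P + (m * toℕ i + toℕ j)) ≡ colWeight β (toℕ j)
    col≡ j = begin
      β y + sum {n} (λ i → P + (m * toℕ i + y))
        ≡⟨ cong (β y +_) (sum-cong-≗ {n} λ i → ring₁ P m (toℕ i) y) ⟩
      β y + sum {n} (λ i → P + y + m * toℕ i)
        ≡⟨ cong (β y +_) (sum-affine n (P + y) m) ⟩
      β y + (n * (P + y) + m * triangle n)
        ≡⟨ ring₂ (β y) n P y m (triangle n) ⟩
      colWeight β y ∎
      where
      y = toℕ j
      ring₁ : ∀ p m x y → p + (m * x + y) ≡ p + y + m * x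
      ring₁ = solve-∀
      ring₂ : ∀ b n p y m t → b + (n * (p + y) + m * t) ≡ b + n * y + (n * p + m * t)
      ring₂ = solve-∀

    rowWeight-mono : StrictlyMonotone (rowWeight α)
    rowWeight-mono x<x′ = +-monoˡ-< rowBase
      (+-mono-<-≤ (α-mono x<x′) (*-monoʳ-≤ (m * m) (<⇒≤ x<x′)))

    colWeight-mono : StrictlyMonotone (colWeight β)
    colWeight-mono y<y′ = +-monoˡ-< colBase
      (+-mono-<-≤ (β-mono y<y′) (*-monoʳ-≤ n (<⇒≤ y<y′)))

    both : ∀ i i′ j j′ → toℕ {n} i ≡ toℕ {n} i′ →
      α (toℕ i) + (m * toℕ i + toℕ j) + β (toℕ j) ≡ α (toℕ i′) + (m * toℕ i′ + toℕ j′) + β (toℕ j′) →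
      i ≡ i′ × j ≡ j′
    both i i′ j j′ x≡x′ eq with refl ← toℕ-injective {i = i} {i′} x≡x′ =
      refl , toℕ-injective {i = j} {j′} (strictlyMonotone⇒injective
        {λ y → α (toℕ i) + (m * toℕ i + y) + β y}
        (λ y<y′ → +-mono-< (+-monoʳ-< (α (toℕ i)) (+-monoʳ-< (m * toℕ i) y<y′)) (β-mono y<y′)) eq)

  Collides : (α β : ℕ → ℕ) → Set
  Collides α β = ∃ λ x → x < n × ∃ λ y → y < m × rowWeight α x ≡ colWeight β y

  -- Decidability lets the position of the interval be chosen constructively.
  collides? : ∀ α β → Dec (Collides α β)
  collides? α β = anyUpTo? (λ x → anyUpTo? (λ y → rowWeight α x ≟ colWeight β y) m) n

  -- The parity of an edge weight minus `t` tells on which side of the row interval the column label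
  -- lies. Halving then leaves `suc h * x + y` up to a constant, and each side holds at most `suc h`
  -- columns, so `x` is determined.
  oddScheme : ∀ g h t → n ≡ suc (2 * g) → m ≡ suc (2 * h) → h ≤ t → t ≤ suc h → t ≤ m →
    ¬ Collides (t +_) (gap t n) → Scheme n m
  oddScheme g h t n≡ m≡ h≤t t≤1+h t≤m ¬coll = rowMajor (t +_) (gap t n)
    (+-monoʳ-< t) (gap-mono t n)
    (λ x<n → <-≤-trans (+-monoʳ-< t x<n) (≤-trans (+-monoˡ-≤ n t≤m) (≤-reflexive (+-comm m n))))
    (λ {y} y<m → ≤-<-trans (gap-≤ t n y) (<-≤-trans (+-monoˡ-< n y<m) (≤-reflexive (+-comm m n))))
    (λ {x} {y} x<n _ eq → gap-avoids t n y x<n (sym eq))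
    w-inj
    (λ {x} {y} x<n y<m eq → ¬coll (x , x<n , y , y<m , eq))
    where
    w : ℕ → ℕ → ℕ
    w x y = suc h * x + y

    below : ∀ {x y} → y < t → t + x + (m * x + y) + gap t n y ≡ t + 2 * w x y
    below {x} {y} y<t = trans
      (cong₂ (λ g k → t + x + (k * x + y) + g) (gap-below y<t) m≡) (ring t h x y)
      where
      ring : ∀ t h x y → t + x + (suc (2 * h) * x + y) + y ≡ t + 2 * (suc h * x + y)
      ring = solve-∀

    above : ∀ {x y} → t ≤ y → t + x + (m * x + y) + gap t n y ≡ t + suc (2 * (w x y + g))
    above {x} {y} t≤y = trans
      (cong₂ (λ g k → t + x + (k * x + y) + g) (trans (gap-above t≤y) (cong (y +_) n≡)) m≡)
      (ring t h x y g)
      where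
      ring : ∀ t h x y g → t + x + (suc (2 * h) * x + y) + (y + suc (2 * g)) ≡
        t + suc (2 * (suc h * x + y + g))
      ring = solve-∀

    -- At most `suc h` columns lie above the interval.
    m≤1+h+t : m ≤ suc h + t
    m≤1+h+t = ≤-trans (≤-reflexive m≡) (≤-trans (≤-reflexive (ring h)) (+-monoʳ-≤ (suc h) h≤t))
      where
      ring : ∀ h → suc (2 * h) ≡ suc h + h
      ring = solve-∀

    w-inj : ∀ {x x′ y y′} → x < n → x′ < n → y < m → y′ < m →
      t + x + (m * x + y) + gap t n y ≡ t + x′ + (m * x′ + y′) + gap t n y′ → x ≡ x′
    w-inj {x} {x′} {y} {y′} _ _ y<m y′<m eq with <-≤-connex y t | <-≤-connex y′ t
    ... | inj₁ y<t | inj₁ y′<t = digit-≡ (suc h)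
      (*-cancelˡ-≡ (w x y) (w x′ y′) 2
        (+-cancelˡ-≡ t _ _ (trans (sym (below {x} y<t)) (trans eq (below {x′} y′<t)))))
      (m≤n⇒m≤n+o y′ (≤-trans y<t t≤1+h)) (m≤n⇒m≤n+o y (≤-trans y′<t t≤1+h))
    ... | inj₁ y<t | inj₂ t≤y′ = contradiction
      (+-cancelˡ-≡ t _ _ (trans (sym (below {x} y<t)) (trans eq (above {x′} t≤y′))))
      (even≢odd (w x y) (w x′ y′ + g))
    ... | inj₂ t≤y | inj₁ y′<t = contradiction
      (+-cancelˡ-≡ t _ _ (trans (sym (below {x′} y′<t)) (trans (sym eq) (above {x} t≤y))))
      (even≢odd (w x′ y′) (w x y + g))
    ... | inj₂ t≤y | inj₂ t≤y′ = digit-≡ (suc h)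
      (+-cancelʳ-≡ g _ _ (*-cancelˡ-≡ (w x y + g) (w x′ y′ + g) 2 (suc-injective
        (+-cancelˡ-≡ t _ _ (trans (sym (above {x} t≤y)) (trans eq (above {x′} t≤y′)))))))
      (≤-trans y<m (≤-trans m≤1+h+t (+-monoʳ-≤ (suc h) t≤y′)))
      (≤-trans y′<m (≤-trans m≤1+h+t (+-monoʳ-≤ (suc h) t≤y)))

  -- For even `m`, an edge weight has the parity of `x + t`, which separates adjacent rows; rows
  -- further apart have disjoint ranges of weights.
  evenScheme : ∀ h t → m ≡ 2 * h → t ≤ n → ¬ Collides (gap t m) (t +_) → Scheme n m
  evenScheme h t m≡ t≤n ¬coll = rowMajor (gap t m) (t +_)
    (gap-mono t m) (+-monoʳ-< t)
    (λ {x} x<n → ≤-<-trans (gap-≤ t m x) (+-monoˡ-< m x<n))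
    (λ y<m → <-≤-trans (+-monoʳ-< t y<m) (+-monoˡ-≤ m t≤n))
    (λ {x} _ y<m → gap-avoids t m x y<m)
    w-inj
    (λ {x} {y} x<n y<m eq → ¬coll (x , x<n , y , y<m , eq))
    where
    w : ℕ → ℕ → ℕ
    w x y = gap t m x + (m * x + y) + (t + y)

    w-parity : ∀ x y → ∃ λ z → w x y ≡ x + t + 2 * z
    w-parity x y with gap-cases t m x
    ... | inj₁ (_ , eq) = h * x + y ,
      trans (cong₂ (λ g k → g + (k * x + y) + (t + y)) eq m≡) (ring x h y t)
      where
      ring : ∀ x h y t → x + (2 * h * x + y) + (t + y) ≡ x + t + 2 * (h * x + y)
      ring = solve-∀
    ... | inj₂ (_ , eq) = h * x + y + h ,
      trans (cong₂ (λ g k → g + (k * x + y) + (t + y)) (trans eq (cong (x +_) m≡)) m≡) (ring x h y t)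
      where
      ring : ∀ x h y t → x + 2 * h + (2 * h * x + y) + (t + y) ≡ x + t + 2 * (h * x + y + h)
      ring = solve-∀

    consecutive : ∀ x y y′ → w x y ≢ w (suc x) y′
    consecutive x y y′ eq with w-parity x y | w-parity (suc x) y′
    ... | z , eq₁ | z′ , eq₂ = even≢odd z z′ (+-cancelˡ-≡ (x + t) _ _
      (trans (sym eq₁) (trans eq (trans eq₂ (sym (+-suc (x + t) (2 * z′)))))))

    -- Within a row, `2 * y` stays below `2 * m`, which is what `m * x` gains over two rows.
    distant : ∀ {x x′ y y′} → y < m → suc x < x′ → w x y < w x′ y′
    distant {x} {x′} {y} {y′} y<m 1+x<x′ = begin-strict
      gap t m x + (m * x + y) + (t + y)      <⟨ +-mono-<-≤ (+-mono-<-≤ (gap-mono t m (≤-trans (n≤1+n _) 1+x<x′))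
                                                  (+-monoʳ-≤ (m * x) (<⇒≤ y<m))) (+-monoʳ-≤ t (<⇒≤ y<m)) ⟩
      gap t m x′ + (m * x + m) + (t + m)     ≡⟨ ring (gap t m x′) m x t ⟩
      gap t m x′ + m * suc (suc x) + t       ≤⟨ +-monoˡ-≤ t (+-monoʳ-≤ (gap t m x′) (*-monoʳ-≤ m 1+x<x′)) ⟩
      gap t m x′ + m * x′ + t                ≤⟨ +-mono-≤ (+-monoʳ-≤ (gap t m x′) (m≤m+n _ y′)) (m≤m+n t y′) ⟩
      gap t m x′ + (m * x′ + y′) + (t + y′)  ∎
      where
      open ≤-Reasoning
      ring : ∀ g m x t → g + (m * x + m) + (t + m) ≡ g + m * suc (suc x) + t
      ring = solve-∀

    ascending : ∀ {x x′ y y′} → y < m → x < x′ → w x y ≢ w x′ y′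
    ascending {x} {x′} {y} {y′} y<m x<x′ with m≤n⇒m<n∨m≡n x<x′
    ... | inj₁ 1+x<x′ = <⇒≢ (distant y<m 1+x<x′)
    ... | inj₂ refl   = consecutive x y y′

    w-inj : ∀ {x x′ y y′} → x < n → x′ < n → y < m → y′ < m → w x y ≡ w x′ y′ → x ≡ x′
    w-inj {x} {x′} _ _ y<m y′<m eq with <-cmp x x′
    ... | tri< x<x′ _ _ = contradiction eq (ascending y<m x<x′)
    ... | tri≈ _ x≡x′ _ = x≡x′
    ... | tri> _ _ x′<x = contradiction (sym eq) (ascending y′<m x′<x)

-- Positions of the interval without coinciding weights

-- Comparing two collisions modulo `suc (m * m)` removes the rows and leaves
-- `r (suc h) y′ ≡ suc (r h y)`. Modulo `suc n`, the left side is 0 or `n` and the right side is 1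
-- or 0.
oddFree : ∀ n m h → n < m → 3 ≤ n →
  Collides n m (h +_) (gap h n) → ¬ Collides n m (suc h +_) (gap (suc h) n)
oddFree n m h n<m 3≤n (x , _ , y , y<m , eq) (x′ , _ , y′ , y′<m , eq′) =
  residues (proj₂ (digits-≡ (suc (m * m)) {x} {x′}
    (m≤n⇒m≤1+n (r<m*m (suc h) y′<m)) (s≤s (r<m*m h y<m)) shifted))
  where
  r : ℕ → ℕ → ℕ
  r t y = gap t n y + n * y

  r<m*m : ∀ t {y} → y < m → r t y < m * m
  r<m*m t {y} y<m = begin-strict
    gap t n y + n * y  ≤⟨ +-monoˡ-≤ (n * y) (gap-≤ t n y) ⟩
    y + n + n * y      <⟨ n<1+n _ ⟩
    suc (y + n + n * y) ≡⟨ ring n y ⟩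
    suc n * suc y      ≤⟨ *-mono-≤ n<m y<m ⟩
    m * m              ∎
    where
    open ≤-Reasoning
    ring : ∀ n y → suc (y + n + n * y) ≡ suc n * suc y
    ring = solve-∀

  shifted : suc (m * m) * x + r (suc h) y′ ≡ suc (m * m) * x′ + suc (r h y)
  shifted = +-cancelˡ-≡ h _ _ (trans (ring h m x (r (suc h) y′))
    (trans (cross {h + x + m * m * x} {r h y} {suc h + x′ + m * m * x′} {r (suc h) y′}
              (rowBase n m) (colBase n m) eq eq′)
           (ring′ h m x′ (r h y))))
    where
    ring : ∀ h m x r → h + (suc (m * m) * x + r) ≡ h + x + m * m * x + r
    ring = solve-∀
    ring′ : ∀ h m x r → suc h + x + m * m * x + r ≡ h + (suc (m * m) * x + suc r)
    ring′ = solve-∀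

  N = suc n
  1<N : 1 < N
  1<N = s≤s (≤-trans (s≤s z≤n) 3≤n)

  r-below : ∀ {t y} → y < t → r t y ≡ N * y + 0
  r-below {t} {y} y<t = trans (cong (_+ n * y) (gap-below y<t)) (sym (+-identityʳ (N * y)))

  r-above : ∀ {t y} → t ≤ y → r t y ≡ N * y + n
  r-above {t} {y} t≤y = trans (cong (_+ n * y) (gap-above t≤y)) (ring n y)
    where
    ring : ∀ n y → y + n + n * y ≡ suc n * y + n
    ring = solve-∀

  suc-r-below : ∀ {t y} → y < t → suc (r t y) ≡ N * y + 1
  suc-r-below {y = y} y<t = trans (cong suc (r-below y<t)) (sym (+-suc (N * y) 0))

  -- The remainder `n` wraps around to 0 and carries into the quotient.
  suc-r-above : ∀ {t y} → t ≤ y → suc (r t y) ≡ N * suc y + 0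
  suc-r-above {y = y} t≤y = trans (cong suc (r-above t≤y)) (ring n y)
    where
    ring : ∀ n y → suc (suc n * y + n) ≡ suc n * suc y + 0
    ring = solve-∀

  residues : r (suc h) y′ ≢ suc (r h y)
  residues eq with <-≤-connex y h | <-≤-connex y′ (suc h)
  ... | inj₁ y<h | inj₁ y′≤h = contradiction
    (proj₂ (digits-≡ N {y′} z<s 1<N (trans (sym (r-below y′≤h)) (trans eq (suc-r-below y<h))))) λ ()
  ... | inj₁ y<h | inj₂ h<y′ = contradiction
    (proj₂ (digits-≡ N {y′} (n<1+n n) 1<N (trans (sym (r-above h<y′)) (trans eq (suc-r-below y<h)))))
    (>⇒≢ (≤-trans (s≤s (s≤s z≤n)) 3≤n))
  -- The only case with equal remainders: the quotients would give `y′ ≡ suc y`, against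
  -- `y′ ≤ h ≤ y`.
  ... | inj₂ h≤y | inj₁ y′≤h = contradiction
    (proj₁ (digits-≡ N {y′} z<s z<s (trans (sym (r-below y′≤h)) (trans eq (suc-r-above h≤y)))))
    (<⇒≢ (<-≤-trans y′≤h (s≤s h≤y)))
  ... | inj₂ h≤y | inj₂ h<y′ = contradiction
    (proj₂ (digits-≡ N {y′} (n<1+n n) z<s (trans (sym (r-above h<y′)) (trans eq (suc-r-above h≤y)))))
    (>⇒≢ (≤-trans (s≤s z≤n) 3≤n))

-- At position `suc k` every row label lies below the interval; at position `k` only the last row is
-- above it, and that row is too heavy to collide. Hence both collisions use `gap` as the identity,
-- and their difference gives 1 ≡ 0 modulo `2 + k`.
evenFree-< : ∀ k m → suc k < m → 2 ≤ k →
  Collides (suc k) m (gap k m) (k +_) → ¬ Collides (suc k) m (gap (suc k) m) (suc k +_)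
evenFree-< k m 1+k<m 2≤k (x , x≤k , y , y<m , eq) (x′ , x′≤k , y′ , y′<m , eq′) = contradiction
  (proj₂ (digits-≡ (2 + k) {y′} {y} (s≤s (s≤s z≤n)) z<s
    (trans (+-comm ((2 + k) * y′) 1) (trans residue (sym (+-identityʳ ((2 + k) * y))))))) λ ()
  where
  P = suc (suc k + m)
  T = triangle (suc k)

  T≤ : T + (2 + k) ≤ m * k
  -- With `k` written as `2 + l` and `m` replaced by its lower bound `4 + l`, twice the slack is a
  -- polynomial in `l` with positive coefficients.
  T≤ with m≤n⇒∃[o]m+o≡n 2≤k
  ... | l , refl = *-cancelˡ-≤ 2 (begin
    2 * (T + (4 + l))                          ≡⟨ *-distribˡ-+ 2 T (4 + l) ⟩
    2 * T + 2 * (4 + l)                        ≡⟨ cong (_+ 2 * (4 + l)) (2*triangle (2 + l)) ⟩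
    (3 + l) * (2 + l) + 2 * (4 + l)            ≤⟨ m≤m+n _ (l * l + 5 * l + 2) ⟩
    (3 + l) * (2 + l) + 2 * (4 + l) + (l * l + 5 * l + 2) ≡⟨ ring l ⟩
    2 * ((4 + l) * (2 + l))                    ≤⟨ *-monoʳ-≤ 2 (*-monoˡ-≤ (2 + l) 1+k<m) ⟩
    2 * (m * (2 + l))                          ∎)
    where
    open ≤-Reasoning
    ring : ∀ l → (3 + l) * (2 + l) + 2 * (4 + l) + (l * l + 5 * l + 2) ≡ 2 * ((4 + l) * (2 + l))
    ring = solve-∀

  -- The term `m * m * k` of the row dominates `m * T` and `(2 + k) * y` of the column by `T≤`.
  lastRow-heavy : ∀ {y} → y < m → colWeight (suc k) m (k +_) y < rowWeight (suc k) m (gap k m) k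
  lastRow-heavy {y} y<m = begin-strict
    k + y + suc k * y + (suc k * P + m * T)     ≡⟨ ring₁ k y (suc k * P) (m * T) ⟩
    k + (2 + k) * y + m * T + suc k * P         ≤⟨ +-mono-≤ (+-monoˡ-≤ (m * T) (+-monoʳ-≤ k (*-monoʳ-≤ (2 + k) (<⇒≤ y<m))))
                                                     (*-monoˡ-≤ P (<⇒≤ 1+k<m)) ⟩
    k + (2 + k) * m + m * T + m * P             ≡⟨ ring₂ k m T (m * P) ⟩
    k + m * (T + (2 + k)) + m * P               ≤⟨ +-monoˡ-≤ (m * P) (+-monoʳ-≤ k (*-monoʳ-≤ m T≤)) ⟩
    k + m * (m * k) + m * P                     <⟨ m<m+n _ (<-≤-trans (<-trans z<s 1+k<m) (m≤m+n m (triangle m))) ⟩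
    k + m * (m * k) + m * P + (m + triangle m)  ≡⟨ ring₃ k m (m * P) (triangle m) ⟩
    k + m + m * m * k + (m * P + triangle m)    ≡⟨ cong (λ g → g + m * m * k + (m * P + triangle m)) (gap-above {k} ≤-refl) ⟨
    gap k m k + m * m * k + (m * P + triangle m) ∎
    where
    open ≤-Reasoning
    ring₁ : ∀ k y p t → k + y + suc k * y + (p + t) ≡ k + (2 + k) * y + t + p
    ring₁ = solve-∀
    ring₂ : ∀ k m t p → k + (2 + k) * m + m * t + p ≡ k + m * (t + (2 + k)) + p
    ring₂ = solve-∀
    ring₃ : ∀ k m p t → k + m * (m * k) + p + (m + t) ≡ k + m + m * m * k + (p + t)
    ring₃ = solve-∀

  x<k : x < k
  x<k = ≤∧≢⇒< (s≤s⁻¹ x≤k) λ { refl → <⇒≢ (lastRow-heavy y<m) (sym eq) }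

  shifted : suc (m * m) * x + suc ((2 + k) * y′) ≡ suc (m * m) * x′ + (2 + k) * y
  shifted = +-cancelˡ-≡ k _ _ (trans (ring k m x y′)
    (trans (cross {x + m * m * x} {k + y + suc k * y} {x′ + m * m * x′} {suc k + y′ + suc k * y′}
              (rowBase (suc k) m) (colBase (suc k) m)
              (subst (λ g → g + m * m * x + rowBase (suc k) m ≡ colWeight (suc k) m (k +_) y)
                (gap-below x<k) eq)
              (subst (λ g → g + m * m * x′ + rowBase (suc k) m ≡ colWeight (suc k) m (suc k +_) y′)
                (gap-below x′≤k) eq′))
           (ring′ k m x′ y)))
    where
    ring : ∀ k m x y → k + (suc (m * m) * x + suc ((2 + k) * y)) ≡ x + m * m * x + (suc k + y + suc k * y)
    ring = solve-∀
    ring′ : ∀ k m x y → x + m * m * x + (k + y + suc k * y) ≡ k + (suc (m * m) * x + (2 + k) * y)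
    ring′ = solve-∀

  [2+k]*y<m*m : ∀ {y} → y < m → (2 + k) * y < m * m
  [2+k]*y<m*m y<m = <-≤-trans (*-monoʳ-< (2 + k) y<m) (*-monoˡ-≤ m 1+k<m)

  residue : suc ((2 + k) * y′) ≡ (2 + k) * y
  residue = proj₂ (digits-≡ (suc (m * m)) {x} {x′}
    (s≤s ([2+k]*y<m*m {y′} y′<m)) (m≤n⇒m≤1+n ([2+k]*y<m*m {y} y<m)) shifted)

module _ (n m : ℕ) (m<n : m < n) (n≤2m : n ≤ 2 * m) (2≤n : 2 ≤ n) where

  private
    P : ℕ
    P = suc (n + m)

    1≤m : 1 ≤ m
    1≤m = *-cancelˡ-< 2 0 m (<-≤-trans (<-trans z<s 2≤n) n≤2m)

    -- Already `colBase` exceeds the weights of rows 0 and 1. So for `t ≤ 2` a colliding row has its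
    -- label above the interval, where `gap` adds `m`.
    firstRows-light : ∀ t {x} y → x < 2 → rowWeight n m (gap t m) x < colWeight n m (t +_) y
    firstRows-light t {x} y (s≤s x≤1) = begin-strict
      gap t m x + m * m * x + (m * P + triangle m)
        ≤⟨ +-monoˡ-≤ _ (+-mono-≤ (≤-trans (gap-≤ t m x) (+-monoˡ-≤ m x≤1)) (*-monoʳ-≤ (m * m) x≤1)) ⟩
      1 + m + m * m * 1 + (m * P + triangle m)
        ≡⟨ ring₁ m (m * P) (triangle m) ⟩
      suc m + m * P + (m * m + 1 * triangle m)
        <⟨ +-mono-<-≤ (+-monoˡ-< (m * P) (s≤s (m<n+m m (<-trans z<s 2≤n))))
             (+-monoʳ-≤ (m * m) (*-monoˡ-≤ (triangle m) 1≤m)) ⟩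
      suc m * P + (m * m + m * triangle m)
        ≡⟨ cong (suc m * P +_) (*-distribˡ-+ m m (triangle m)) ⟨
      suc m * P + m * triangle (suc m)
        ≤⟨ +-mono-≤ (*-monoˡ-≤ P m<n) (*-monoʳ-≤ m (triangle-mono-≤ m<n)) ⟩
      colBase n m
        ≤⟨ m≤n+m _ (t + y + n * y) ⟩
      t + y + n * y + colBase n m ∎
      where
      open ≤-Reasoning
      ring₁ : ∀ m p t → 1 + m + m * m * 1 + (p + t) ≡ suc m + p + (m * m + 1 * t)
      ring₁ = solve-∀

    record Collision (t : ℕ) : Set where
      constructor collision
      field
        {x y} : ℕ
        y<m : y < m
        eq  : x + m + m * m * x + rowBase n m ≡ t + y + n * y + colBase n m

    fromCollides : ∀ {t} → t ≤ 2 → Collides n m (gap t m) (t +_) → Collision t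
    fromCollides {t} t≤2 (x , _ , y , y<m , eq) = collision {x = x} {y} y<m
      (subst (λ g → g + m * m * x + rowBase n m ≡ colWeight n m (t +_) y)
        (gap-above (≤-trans t≤2 (≮⇒≥ λ x<2 → <⇒≢ (firstRows-light t {x} y x<2) eq))) eq)

    open Collision

    shifted : ∀ {t t′} (c : Collision t) (c′ : Collision t′) →
      suc (m * m) * x c + (suc n * y c′ + t′) ≡ suc (m * m) * x c′ + (suc n * y c + t)
    shifted {t} {t′} c c′ = +-cancelˡ-≡ m _ _ (trans (ring m n (x c) (y c′) t′)
      (trans (cross {x c + m + m * m * x c} {t + y c + n * y c}
                {x c′ + m + m * m * x c′} {t′ + y c′ + n * y c′}
                (rowBase n m) (colBase n m) (eq c) (eq c′))
             (sym (ring m n (x c′) (y c) t))))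
      where
      ring : ∀ m n x y t → m + (suc (m * m) * x + (suc n * y + t)) ≡ x + m + m * m * x + (t + y + n * y)
      ring = solve-∀

    close : ∀ {t t′} → t ≤ 2 → (c : Collision t) (c′ : Collision t′) → x c < x c′ + 2
    close {t} t≤2 c c′ = digit-< (suc (m * m)) 2 {x c} (shifted c c′) (m≤n⇒m≤n+o _
      -- The `m` added on both sides is the excess of `suc (2 * m) * m + 2` over `suc (m * m) * 2`;
      -- on the left, `m < suc n` lets it complete the factor `suc (y c)`.
      (+-cancelʳ-< m _ _ (begin-strict
        suc n * y c + t + m        <⟨ +-mono-≤-< (+-monoʳ-≤ (suc n * y c) t≤2) (m<n⇒m<1+n m<n) ⟩
        suc n * y c + 2 + suc n    ≡⟨ ring₁ (suc n) (y c) ⟩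
        suc n * suc (y c) + 2      ≤⟨ +-monoˡ-≤ 2 (*-mono-≤ (s≤s n≤2m) (y<m c)) ⟩
        suc (2 * m) * m + 2        ≡⟨ ring₂ m ⟩
        suc (m * m) * 2 + m        ∎)))
      where
      open ≤-Reasoning
      ring₁ : ∀ n y → n * y + 2 + n ≡ n * suc y + 2
      ring₁ = solve-∀
      ring₂ : ∀ m → suc (2 * m) * m + 2 ≡ suc (m * m) * 2 + m
      ring₂ = solve-∀

    -- With equal rows, the two positions would be equal remainders modulo `suc n`.
    distinct : ∀ {t t′} → t ≤ 2 → t′ ≤ 2 → t ≢ t′ → (c : Collision t) (c′ : Collision t′) → x c ≢ x c′
    distinct {t} {t′} t≤2 t′≤2 t≢t′ c c′ x≡x′ = t≢t′ (sym (proj₂ (digits-≡ (suc n) {y c′}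
      (s≤s (≤-trans t′≤2 2≤n)) (s≤s (≤-trans t≤2 2≤n))
      (+-cancelˡ-≡ (suc (m * m) * x c) _ _
        (trans (shifted c c′) (cong (λ z → suc (m * m) * z + (suc n * y c + t)) (sym x≡x′)))))))

  -- Collisions at all three positions would occur in three distinct rows, any two of them adjacent.
  evenFree-> : Collides n m (gap 0 m) (0 +_) → Collides n m (gap 1 m) (1 +_) →
    ¬ Collides n m (gap 2 m) (2 +_)
  evenFree-> coll₀ coll₁ coll₂ = ¬-three-close
    (distinct z≤n 1≤2 (λ ()) c₀ c₁) (distinct z≤n ≤-refl (λ ()) c₀ c₂) (distinct 1≤2 ≤-refl (λ ()) c₁ c₂)
    (close z≤n c₀ c₁) (close 1≤2 c₁ c₀) (close z≤n c₀ c₂) (close ≤-refl c₂ c₀)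
    (close 1≤2 c₁ c₂) (close ≤-refl c₂ c₁)
    where
    1≤2 : 1 ≤ 2
    1≤2 = s≤s z≤n
    c₀ : Collision 0
    c₀ = fromCollides z≤n coll₀
    c₁ : Collision 1
    c₁ = fromCollides 1≤2 coll₁
    c₂ : Collision 2
    c₂ = fromCollides ≤-refl coll₂

-- With at least twice as many rows as columns, even the heaviest row weighs less than `colBase`, so
-- one position suffices.
evenFree-≫ : ∀ k l → 2 * suc l ≤ suc k → ¬ Collides (suc k) (suc l) (gap 0 (suc l)) (0 +_)
evenFree-≫ k l 2m≤n (x , s≤s x≤k , y , _ , eq) = <⇒≢ (begin-strict
  x + m + m * m * x + (m * P + triangle m)
    ≤⟨ +-mono-≤ (+-mono-≤ (+-monoˡ-≤ m x≤k) (*-monoʳ-≤ (m * m) x≤k)) (+-monoʳ-≤ (m * P) triangle-m≤) ⟩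
  k + m + m * m * k + (m * P + l * P)
    <⟨ +-monoˡ-< _ (+-monoˡ-< (m * m * k) {k + m} (m≤n⇒m≤1+n ≤-refl)) ⟩
  P + m * m * k + (m * P + l * P)
    ≡⟨ ring l k P ⟩
  2 * m * P + m * (m * k)
    ≤⟨ +-mono-≤ (*-monoˡ-≤ P 2m≤n) (*-monoʳ-≤ m m*k≤) ⟩
  colBase n m
    ≤⟨ m≤n+m _ (y + n * y) ⟩
  y + n * y + colBase n m ∎) eq
  where
  open ≤-Reasoning
  n = suc k
  m = suc l
  P = suc (n + m)
  ring : ∀ l k p → p + suc l * suc l * k + (suc l * p + l * p) ≡ 2 * suc l * p + suc l * (suc l * k)
  ring = solve-∀
  triangle-m≤ : triangle m ≤ l * P
  triangle-m≤ = begin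
    triangle m      ≤⟨ m≤m+n _ _ ⟩
    2 * triangle m  ≡⟨ 2*triangle l ⟩
    m * l           ≡⟨ *-comm m l ⟩
    l * m           ≤⟨ *-monoʳ-≤ l (m≤n⇒m≤1+n (m≤n+m m n)) ⟩
    l * P           ∎
  m*k≤ : m * k ≤ triangle n
  m*k≤ = *-cancelˡ-≤ 2 (begin
    2 * (m * k)     ≡⟨ *-assoc 2 m k ⟨
    2 * m * k       ≤⟨ *-monoˡ-≤ k 2m≤n ⟩
    n * k           ≡⟨ 2*triangle k ⟨
    2 * triangle n  ∎)

-- Choice of the construction by parity and size

even-or-odd : ∀ n → (∃ λ h → n ≡ 2 * h) ⊎ (∃ λ h → n ≡ suc (2 * h))
even-or-odd zero    = inj₁ (0 , refl)
even-or-odd (suc n) with even-or-odd n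
... | inj₁ (h , refl) = inj₂ (h , refl)
... | inj₂ (h , refl) = inj₁ (suc h , sym (*-suc 2 h))

evenColumns : ∀ n m h → m ≡ 2 * h → 3 ≤ n → 1 ≤ m → n ≢ m → Scheme n m
evenColumns n@(suc k) m@(suc l) h m≡2h 3≤n _ n≢m with <-cmp n m
... | tri≈ _ n≡m _ = contradiction n≡m n≢m
... | tri< n<m _ _ with collides? n m (gap k m) (k +_)
...   | no ¬coll = evenScheme n m h k m≡2h (n≤1+n k) ¬coll
...   | yes coll = evenScheme n m h n m≡2h ≤-refl (evenFree-< k m n<m (s≤s⁻¹ 3≤n) coll)
evenColumns n@(suc k) m@(suc l) h m≡2h 3≤n _ n≢m | tri> _ _ m<n with ≤-total n (2 * m)
...   | inj₂ 2m≤n = evenScheme n m h 0 m≡2h z≤n (evenFree-≫ k l 2m≤n)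
...   | inj₁ n≤2m with collides? n m (gap 0 m) (0 +_) | collides? n m (gap 1 m) (1 +_)
...     | no ¬coll₀ | _         = evenScheme n m h 0 m≡2h z≤n ¬coll₀
...     | yes _     | no ¬coll₁ = evenScheme n m h 1 m≡2h (s≤s z≤n) ¬coll₁
...     | yes coll₀ | yes coll₁ = evenScheme n m h 2 m≡2h 2≤n (evenFree-> n m m<n n≤2m 2≤n coll₀ coll₁)
  where
  2≤n : 2 ≤ n
  2≤n = ≤-trans (n≤1+n 2) 3≤n

oddSides : ∀ n m g h → n ≡ suc (2 * g) → m ≡ suc (2 * h) → 3 ≤ n → n < m → Scheme n m
oddSides n m g h n≡ m≡ 3≤n n<m = choose (collides? n m (h +_) (gap h n))
  where
  1+h≤m : suc h ≤ m
  1+h≤m = ≤-trans (s≤s (m≤m+n h _)) (≤-reflexive (sym m≡))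
  choose : Dec (Collides n m (h +_) (gap h n)) → Scheme n m
  choose (no ¬coll) = oddScheme n m g h h n≡ m≡ ≤-refl (n≤1+n h) (<⇒≤ 1+h≤m) ¬coll
  choose (yes coll) = oddScheme n m g h (suc h) n≡ m≡ (n≤1+n h) ≤-refl 1+h≤m (oddFree n m h n<m 3≤n coll)

scheme : ∀ n m → 3 ≤ n → 3 ≤ m → n ≢ m → Scheme n m
scheme n m 3≤n 3≤m n≢m with even-or-odd n | even-or-odd m
... | _            | inj₁ (h , m≡) = evenColumns n m h m≡ 3≤n (≤-trans (s≤s z≤n) 3≤m) n≢m
... | inj₁ (g , n≡) | inj₂ _       = transpose (evenColumns m n g n≡ 3≤m (≤-trans (s≤s z≤n) 3≤n) (n≢m ∘ sym))
... | inj₂ (g , n≡) | inj₂ (h , m≡) with <-cmp n m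
...   | tri< n<m _ _ = oddSides n m g h n≡ m≡ 3≤n n<m
...   | tri≈ _ n≡m _ = contradiction n≡m n≢m
-- The odd construction wants the smaller side as rows.
...   | tri> _ _ m<n = transpose (oddSides m n h g m≡ n≡ 3≤m m<n)

theorem2p2 : (n m : ℕ) → 3 ≤ n → 3 ≤ m → n ≢ m → WeakOrderedSuperTATGraph (K n m)
theorem2p2 n m 3≤n 3≤m n≢m =
  scheme⇒graph (scheme n m 3≤n 3≤m n≢m) (≤-trans (≤-trans (s≤s z≤n) 3≤n) (m≤m+n n m))
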